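{- Let $n\geq 9$ with $n\equiv 0 \pmod 3$, and let $G$ be the $n$-vertex nested triangles graph on vertices $v_1,\dots,v_n$. Let $\tau(v_i)=i$ for $i=1,\dots,n$. Then every planar straight-line grid drawing story of the graph story $\langle G,\tau,9\rangle$ lies on a grid of size $\Omega(n)\times\Omega(n)$; i.e., there is an absolute constant $c>0$ such that for every such $n$ and every such drawing story, any grid $[a,b]\times[c',d]$ whose bounding box encloses all the drawings of the story has width and height at least $c\cdot n$.
   Context: The $n$-vertex nested triangles graph ($n\equiv 0\pmod 3$) has vertices $v_1,\dots,v_n$ and consists of the 3-cycles $C_i=(v_{i-2},v_{i-1},v_i)$ for $i=3,6,\dots,n$, together with the edges $(v_i,v_{i+3})$ for $i=1,\dots,n-3$. A graph story $\langle G,\tau,W\rangle$ consists of a graph $G$ with $n$ vertices, a bijection $\tau:V(G)\to\{1,\dots,n\}$, and a positive integer $W$ (the window size); for $t=1,\dots,n+W-1$, $G_t$ is the subgraph of $G$ induced by $\{v: t-W<\tau(v)\leq t\}$. A drawing story of $\langle G,\tau,W\rangle$ is a sequence $\Gamma_1,\dots,\Gamma_{n+W-1}$ where $\Gamma_t$ is a drawing of $G_t$, every vertex is drawn at the same point in all $\Gamma_t$ containing it, and every edge is drawn by the same curve in all $\Gamma_t$ containing it. It is planar, straight-line, or on the grid if every $\Gamma_t$ is planar, has straight-line segment edges, or has all vertices at integer-coordinate points, respectively. The grid $[a,b]\times[c,d]$ (integers $a<b$, $c<d$) has width $b-a+1$ and height $d-c+1$; a drawing lies on a $w\times h$ grid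 if it is enclosed by the bounding box of some grid of width $w$ and height $h$. -}

module Defs where

open import Data.Nat as ℕ using (ℕ; _≤_; _<_; _/_)
open import Data.Integer as ℤ using (ℤ; +_)
open import Data.Rational as ℚ using (ℚ; 0ℚ; 1ℚ)
open import Data.Product using (_×_; _,_; Σ; ∃; ∃-syntax)
open import Data.Sum using (_⊎_)
open import Relation.Nullary using (¬_)
open import Relation.Binary.PropositionalEquality using (_≡_; _≢_)

IsVertex : ℕ → ℕ → Set
IsVertex n i = 1 ≤ i × i ≤ n

-- The block (triangle) index of vertex v_i: v_{3k+1}, v_{3k+2}, v_{3k+3}
-- form the 3-cycle C_{3k+3}.
block : ℕ → ℕ
block i = (i ℕ.∸ 1) / 3

NTAdj : ℕ → ℕ → ℕ → Set
NTAdj n i j =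
  IsVertex n i × IsVertex n j ×
  ((i ≢ j × block i ≡ block j) ⊎ (j ≡ i ℕ.+ 3 ⊎ i ≡ j ℕ.+ 3))

-- Graph story with τ(v_i) = i and window size W:
-- v_i belongs to G_t iff t - W < i ≤ t.
InWindow : ℕ → ℕ → ℕ → ℕ → Set
InWindow n W t i = IsVertex n i × i ≤ t × t < i ℕ.+ W

Pointℚ : Set
Pointℚ = ℚ × ℚ

Pointℤ : Set
Pointℤ = ℤ × ℤ

toℚ : ℤ → ℚ
toℚ z = z ℚ./ 1

embed : Pointℤ → Pointℚ
embed (x , y) = toℚ x , toℚ y

-- z lies on the closed straight-line segment from p to q.
-- (Intersections of segments with integer endpoints are rational
-- polytopes, so rational points suffice.)
OnSegment : Pointℚ → Pointℚ → Pointℚ → Set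
OnSegment (zx , zy) (px , py) (qx , qy) =
  ∃[ l ] (0ℚ ℚ.≤ l × l ℚ.≤ 1ℚ ×
          zx ≡ px ℚ.+ l ℚ.* (qx ℚ.- px) ×
          zy ≡ py ℚ.+ l ℚ.* (qy ℚ.- py))

PlanarStraightLine : (Adj : ℕ → ℕ → Set) (In : ℕ → Set) (pos : ℕ → Pointℤ) → Set
PlanarStraightLine Adj In pos =
  (∀ u v → In u → In v → u ≢ v → pos u ≢ pos v)
  ×
  (∀ u v w → In u → In v → In w → Adj u v → w ≢ u → w ≢ v →
     ¬ OnSegment (embed (pos w)) (embed (pos u)) (embed (pos v)))
  ×
  (∀ u v x y → In u → In v → In x → In y → Adj u v → Adj x y →
     ¬ (u ≡ x × v ≡ y) → ¬ (u ≡ y × v ≡ x) →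
     ∀ z → OnSegment z (embed (pos u)) (embed (pos v)) →
           OnSegment z (embed (pos x)) (embed (pos y)) →
     ∃[ a ] ((a ≡ u ⊎ a ≡ v) × (a ≡ x ⊎ a ≡ y) × z ≡ embed (pos a)))

-- A planar straight-line grid drawing story of ⟨G, τ, W⟩ (τ(v_i) = i) with G
-- the n-vertex nested triangles graph: a single position per vertex (so
-- vertices and straight-line edges are drawn identically in all Γ_t), and
-- every Γ_t, t = 1, …, n + W - 1, is planar.
PlanarGridDrawingStory : (n W : ℕ) → (ℕ → Pointℤ) → Set
PlanarGridDrawingStory n W pos =
  ∀ t → 1 ≤ t → t ≤ n ℕ.+ W ℕ.∸ 1 →
    PlanarStraightLine (NTAdj n) (InWindow n W t) pos

-- The grid [a,b] × [c,d] encloses every drawing of the story, i.e. all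
-- vertices (hence all straight-line edges) lie in its bounding box.
Encloses : (n : ℕ) (pos : ℕ → Pointℤ) (a b c d : ℤ) → Set
Encloses n pos a b c d =
  ∀ i → IsVertex n i →
    (a ℤ.≤ Data.Product.proj₁ (pos i) × Data.Product.proj₁ (pos i) ℤ.≤ b) ×
    (c ℤ.≤ Data.Product.proj₂ (pos i) × Data.Product.proj₂ (pos i) ℤ.≤ d)

{-# OPTIONS --safe #-}

-- Let A, M, B be three consecutive triangles. If A and B were both outside M,
-- contracting A and B and adding a vertex inside M would give a planar drawing
-- of K₃,₃. So A or B lies inside M and has smaller height than M. The heights
-- of the n/3 triangles thus have no valley: they increase and then decrease
-- strictly, so the largest is at least about n/6. Exchanging the coordinates
-- gives the width.
-- The non-planarity is van Kampen's parity argument. For two disjoint segments,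
-- the parity of the number of end points lying below the other segment depends
-- only on the order of the four abscissae. Summing this relation over suitable
-- pairs of edges leaves the parities that tell whether A and B lie inside M.
module Submission where

open import Defs
open import Algebra.Bundles using (AbelianGroup)
open import Data.Bool using (Bool; true; false; _∧_; _∨_; _xor_; not)
open import Data.Bool.Properties using (∨-comm; xor-comm; xor-assoc; xor-identityʳ; xor-same)
open import Data.Bool.Solver using (module xor-∧-Solver)
open import Data.Integer as ℤ using (ℤ; +_; 0ℤ; 1ℤ; _+_; _*_; -_; _-_; _<_; _≤_; _⊔_; _⊓_)
open import Data.Integer.Properties
open import Data.Integer.Tactic.RingSolver using (solve-∀)
open import Data.List using (List; []; _∷_; _++_; foldr; concatMap)
open import Data.List.Relation.Unary.All as All using (All; []; _∷_)
open import Data.Nat as ℕ using (ℕ; zero; suc; z≤n; s≤s; NonZero)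
open import Data.Nat.Divisibility using (_∣_; divides; divides-refl)
open import Data.Nat.DivMod using (+-distrib-/-∣ʳ; m*n/n≡m)
import Data.Nat.Properties as ℕ
open import Data.Product using (_×_; _,_; ∃-syntax; proj₁; proj₂)
import Data.Product.Properties as ×
open import Data.Rational as ℚ using (0ℚ; 1ℚ; toℚᵘ)
import Data.Rational.Properties as ℚ
open import Data.Rational.Unnormalised as ℚᵘ using (mkℚᵘ; *≡*; *≤*)
import Data.Rational.Unnormalised.Properties as ℚᵘ
open import Data.Sum as ⊎ using (_⊎_; inj₁; inj₂)
import Data.Sum.Properties as ⊎
open import Data.Unit using (⊤; tt)
import Data.Unit.Properties as ⊤
open import Function using (_∘_)
open import Relation.Binary.Definitions using (tri<; tri≈; tri>; DecidableEquality)
open import Relation.Binary.PropositionalEquality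
open import Relation.Nullary
  using (¬_; Dec; yes; no; contradiction; does; ¬?; _×-dec_; _⊎-dec_)
open import Relation.Nullary.Decidable using (dec-true; dec-false; from-yes)

open import Algebra.Properties.Group (AbelianGroup.group +-0-abelianGroup) using (∙-cancelˡ)

-- Positivity in the integers

0<-* : ∀ {i j} → 0ℤ < i → 0ℤ < j → 0ℤ < i * j
0<-* {i} {j} 0<i 0<j =
  subst (_< i * j) (*-zeroʳ i) (*-monoˡ-<-pos i {{ℤ.positive 0<i}} 0<j)

0<-+ : ∀ {i j} → 0ℤ < i → 0ℤ < j → 0ℤ < i + j
0<-+ = +-mono-<

0<-cancelˡ : ∀ {i j} → 0ℤ < i → 0ℤ < i * j → 0ℤ < j
0<-cancelˡ {i} {j} 0<i 0<ij = *-cancelˡ-<-nonNeg i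
  {{ℤ.nonNegative (<⇒≤ 0<i)}} (subst (_< i * j) (sym (*-zeroʳ i)) 0<ij)

i<j⇒0<j-i : ∀ {i j} → i < j → 0ℤ < j - i
i<j⇒0<j-i {i} {j} i<j = subst (_< j - i) (+-inverseʳ i) (+-monoˡ-< (- i) i<j)

0<j-i⇒i<j : ∀ {i j} → 0ℤ < j - i → i < j
0<j-i⇒i<j {i} {j} p = subst₂ _<_ (+-identityˡ i) (eq i j) (+-monoˡ-< i p)
  where
  eq : ∀ i j → j - i + i ≡ j
  eq = solve-∀

-- Orientation and common points of segments

X Y : Pointℤ → ℤ
X = proj₁
Y = proj₂

-- Twice the signed area of the triangle, positive when r lies to the left of the line directed from
-- p to q.
orient : Pointℤ → Pointℤ → Pointℤ → ℤ
orient p q r = (X q - X p) * (Y r - Y p) - (Y q - Y p) * (X r - X p)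

-- A common point of the segments pq and rs, in barycentric coordinates
-- scaled to integers.
record Meets (p q r s : Pointℤ) : Set where
  field
    {α β γ δ}   : ℤ
    0≤α         : 0ℤ ≤ α
    0≤β         : 0ℤ ≤ β
    0≤γ         : 0ℤ ≤ γ
    0≤δ         : 0ℤ ≤ δ
    0<α+β       : 0ℤ < α + β
    α+β≡γ+δ     : α + β ≡ γ + δ
    X-common    : α * X p + β * X q ≡ γ * X r + δ * X s
    Y-common    : α * Y p + β * Y q ≡ γ * Y r + δ * Y s

meets-swapˡ : ∀ {p q r s} → Meets p q r s → Meets q p r s
meets-swapˡ {p} {q} {r} {s} m = record
  { 0≤α = 0≤β ; 0≤β = 0≤α ; 0≤γ = 0≤γ ; 0≤δ = 0≤δ
  ; 0<α+β = subst (0ℤ <_) (+-comm α _) 0<α+β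
  ; α+β≡γ+δ = trans (+-comm β _) α+β≡γ+δ
  ; X-common = trans (+-comm (β * X q) _) X-common
  ; Y-common = trans (+-comm (β * Y q) _) Y-common
  }
  where open Meets m

meets-sym : ∀ {p q r s} → Meets p q r s → Meets r s p q
meets-sym m = record
  { 0≤α = 0≤γ ; 0≤β = 0≤δ ; 0≤γ = 0≤α ; 0≤δ = 0≤β
  ; 0<α+β = subst (0ℤ <_) α+β≡γ+δ 0<α+β
  ; α+β≡γ+δ = sym α+β≡γ+δ
  ; X-common = sym X-common ; Y-common = sym Y-common
  }
  where open Meets m

meets-swapʳ : ∀ {p q r s} → Meets p q r s → Meets p q s r
meets-swapʳ m = meets-sym (meets-swapˡ (meets-sym m))

orient-swap : ∀ p q r → orient q p r ≡ - orient p q r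
orient-swap (a , b) (c , d) (e , f) = eq a b c d e f
  where
  eq : ∀ a b c d e f → (a - c) * (f - d) - (b - d) * (e - c)
                     ≡ - ((c - a) * (f - b) - (d - b) * (e - a))
  eq = solve-∀

-- Each segment is cut in the ratio of the distances of its ends from the other line, so the four
-- areas themselves, up to sign, serve as weights.
proper-crossing : ∀ {p q r s} →
  0ℤ < orient r s p → 0ℤ < - orient r s q →
  0ℤ < - orient p q r → 0ℤ < orient p q s → Meets p q r s
proper-crossing {a , b} {c , d} {e , f} {g , h} p+ q- r- s+ = record
  { 0≤α = <⇒≤ q- ; 0≤β = <⇒≤ p+ ; 0≤γ = <⇒≤ s+ ; 0≤δ = <⇒≤ r-
  ; 0<α+β = 0<-+ q- p+
  ; α+β≡γ+δ = e₀ a b c d e f g h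
  ; X-common = e₁ a b c d e f g h
  ; Y-common = e₂ a b c d e f g h
  }
  where
  e₀ : ∀ a b c d e f g h →
    - ((g - e) * (d - f) - (h - f) * (c - e)) + ((g - e) * (b - f) - (h - f) * (a - e))
    ≡ ((c - a) * (h - b) - (d - b) * (g - a)) + - ((c - a) * (f - b) - (d - b) * (e - a))
  e₀ = solve-∀
  e₁ : ∀ a b c d e f g h →
    - ((g - e) * (d - f) - (h - f) * (c - e)) * a + ((g - e) * (b - f) - (h - f) * (a - e)) * c
    ≡ ((c - a) * (h - b) - (d - b) * (g - a)) * e + - ((c - a) * (f - b) - (d - b) * (e - a)) * g
  e₁ = solve-∀
  e₂ : ∀ a b c d e f g h →
    - ((g - e) * (d - f) - (h - f) * (c - e)) * b + ((g - e) * (b - f) - (h - f) * (a - e)) * d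
    ≡ ((c - a) * (h - b) - (d - b) * (g - a)) * f + - ((c - a) * (f - b) - (d - b) * (e - a)) * h
  e₂ = solve-∀

-- The missing signs of orient come from instances of the Plücker relation
-- (s − r)[p q r] = (p − r)[r s q] − (q − r)[r s p], applied to abscissae.
nested-meets : ∀ {p q r s} → X p < X r → X r < X q → X p < X s → X s < X q →
  0ℤ < - orient p q r → 0ℤ < orient p q s → Meets p q r s
nested-meets {a , b} {c , d} {e , f} {g , h} p<r r<q p<s s<q r- s+ = proper-crossing
  (0<-cancelˡ 0<q-p (subst (0ℤ <_) (sym (e₁ a b c d e f g h))
    (0<-+ (0<-* s+ (i<j⇒0<j-i p<r)) (0<-* r- (i<j⇒0<j-i p<s)))))
  (0<-cancelˡ 0<q-p (subst (0ℤ <_) (sym (e₂ a b c d e f g h))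
    (0<-+ (0<-* s+ (i<j⇒0<j-i r<q)) (0<-* r- (i<j⇒0<j-i s<q)))))
  r- s+
  where
  0<q-p = i<j⇒0<j-i (<-trans p<r r<q)
  e₁ : ∀ a b c d e f g h →
    (c - a) * ((g - e) * (b - f) - (h - f) * (a - e))
    ≡ ((c - a) * (h - b) - (d - b) * (g - a)) * (e - a)
      + - ((c - a) * (f - b) - (d - b) * (e - a)) * (g - a)
  e₁ = solve-∀
  e₂ : ∀ a b c d e f g h →
    (c - a) * - ((g - e) * (d - f) - (h - f) * (c - e))
    ≡ ((c - a) * (h - b) - (d - b) * (g - a)) * (c - e)
      + - ((c - a) * (f - b) - (d - b) * (e - a)) * (c - g)
  e₂ = solve-∀

module _ {p q r s : Pointℤ} (p<r : X p < X r) (r<q : X r < X q) (q<s : X q < X s) where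

  private
    0<q-r = i<j⇒0<j-i r<q
    0<r-p = i<j⇒0<j-i p<r
    0<s-q = i<j⇒0<j-i q<s
    0<s-r = i<j⇒0<j-i (<-trans r<q q<s)
    0<q-p = i<j⇒0<j-i (<-trans p<r r<q)

    e₁ : ∀ a b c d e f g h →
      (c - e) * ((g - e) * (b - f) - (h - f) * (a - e))
      ≡ (e - a) * - ((g - e) * (d - f) - (h - f) * (c - e))
        + (g - e) * - ((c - a) * (f - b) - (d - b) * (e - a))
    e₁ = solve-∀
    e₂ : ∀ a b c d e f g h →
      (c - e) * ((c - a) * (h - b) - (d - b) * (g - a))
      ≡ (g - c) * - ((c - a) * (f - b) - (d - b) * (e - a))
        + (c - a) * - ((g - e) * (d - f) - (h - f) * (c - e))
    e₂ = solve-∀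
    e₃ : ∀ a b c d e f g h →
      (c - e) * - ((g - e) * (b - f) - (h - f) * (a - e))
      ≡ (e - a) * ((g - e) * (d - f) - (h - f) * (c - e))
        + (g - e) * ((c - a) * (f - b) - (d - b) * (e - a))
    e₃ = solve-∀
    e₄ : ∀ a b c d e f g h →
      (c - e) * - ((c - a) * (h - b) - (d - b) * (g - a))
      ≡ (g - c) * ((c - a) * (f - b) - (d - b) * (e - a))
        + (c - a) * ((g - e) * (d - f) - (h - f) * (c - e))
    e₄ = solve-∀

  -- Over the common range of abscissae, from r to q, the segment rs starts under pq and ends above
  -- it.
  overlapping-meets-below : 0ℤ < - orient p q r → 0ℤ < - orient r s q → Meets p q r s
  overlapping-meets-below r- q- = proper-crossing
    (0<-cancelˡ 0<q-r (subst (0ℤ <_) (sym (e₁ (X p) (Y p) (X q) (Y q) (X r) (Y r) (X s) (Y s)))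
      (0<-+ (0<-* 0<r-p q-) (0<-* 0<s-r r-))))
    q- r-
    (0<-cancelˡ 0<q-r (subst (0ℤ <_) (sym (e₂ (X p) (Y p) (X q) (Y q) (X r) (Y r) (X s) (Y s)))
      (0<-+ (0<-* 0<s-q r-) (0<-* 0<q-p q-))))

  -- The mirror image: reading rs as sr restores the signs that `proper-crossing` expects.
  overlapping-meets-above : 0ℤ < orient p q r → 0ℤ < orient r s q → Meets p q r s
  overlapping-meets-above r+ q+ = meets-swapʳ (proper-crossing
    (subst (0ℤ <_) (sym (orient-swap r s p))
      (0<-cancelˡ 0<q-r (subst (0ℤ <_) (sym (e₃ (X p) (Y p) (X q) (Y q) (X r) (Y r) (X s) (Y s)))
        (0<-+ (0<-* 0<r-p q+) (0<-* 0<s-r r+)))))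
    (subst (0ℤ <_) (sym (trans (cong -_ (orient-swap r s q)) (neg-involutive _))) q+)
    (0<-cancelˡ 0<q-r (subst (0ℤ <_) (sym (e₄ (X p) (Y p) (X q) (Y q) (X r) (Y r) (X s) (Y s)))
      (0<-+ (0<-* 0<s-q r+) (0<-* 0<q-p q+))))
    r+)

-- The common point is r itself, an end of rs, whence the weight `δ` is zero.
between-collinear-meets : ∀ {p q r} s → X p < X r → X r < X q →
  orient p q r ≡ 0ℤ → Meets p q r s
between-collinear-meets {a , b} {c , d} {e , f} (g , h) p<r r<q col = record
  { α = c - e ; β = e - a ; γ = c - a ; δ = 0ℤ
  ; 0≤α = <⇒≤ (i<j⇒0<j-i r<q) ; 0≤β = <⇒≤ (i<j⇒0<j-i p<r)
  ; 0≤γ = <⇒≤ (i<j⇒0<j-i (<-trans p<r r<q)) ; 0≤δ = ≤-refl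
  ; 0<α+β = 0<-+ (i<j⇒0<j-i r<q) (i<j⇒0<j-i p<r)
  ; α+β≡γ+δ = e₀ a c e
  ; X-common = e₁ a c e g
  ; Y-common = trans (e₂ a b c d e f h)
      (trans (cong (λ t → (c - a) * f + 0ℤ * h - t) col) (+-identityʳ _))
  }
  where
  e₀ : ∀ a c e → c - e + (e - a) ≡ c - a + 0ℤ
  e₀ = solve-∀
  e₁ : ∀ a c e g → (c - e) * a + (e - a) * c ≡ (c - a) * e + 0ℤ * g
  e₁ = solve-∀
  e₂ : ∀ a b c d e f h → (c - e) * b + (e - a) * d
    ≡ (c - a) * f + 0ℤ * h - ((c - a) * (f - b) - (d - b) * (e - a))
  e₂ = solve-∀

-- Parity of segments

_◁_ : Pointℤ → Pointℤ → Bool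
p ◁ q = does (X p ℤ.<? X q)

clockwise : Pointℤ → Pointℤ → Pointℤ → Bool
clockwise p q r = does (orient p q r ℤ.<? 0ℤ)

-- For a segment directed to the right, clockwise means underneath; `below` tries both directions.
belowʳ : Pointℤ → Pointℤ → Pointℤ → Bool
belowʳ p q r = (q ◁ p) ∧ (p ◁ r) ∧ clockwise q r p

below : Pointℤ → Pointℤ → Pointℤ → Bool
below p q r = belowʳ p q r ∨ belowʳ p r q

◁-true : ∀ p q → X p < X q → p ◁ q ≡ true
◁-true _ _ = dec-true (_ ℤ.<? _)

◁-false : ∀ p q → X p < X q → q ◁ p ≡ false
◁-false p q p<q = dec-false (_ ℤ.<? _) (<-asym p<q)

◁-not : ∀ p q → X p ≢ X q → p ◁ q ≡ not (q ◁ p)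
◁-not p q p≢q with <-cmp (X p) (X q)
... | tri< p<q _ _ = trans (◁-true p q p<q) (cong not (sym (◁-false p q p<q)))
... | tri≈ _ p≡q _ = contradiction p≡q p≢q
... | tri> _ _ q<p = trans (◁-false q p q<p) (cong not (sym (◁-true q p q<p)))

-- The last four terms turn "below pq" into "above pq" for the end points r and s.
-- Each end of the common range of abscissae is then counted once, if rs lies
-- above pq there; for disjoint segments the two ends agree.
linking : Pointℤ → Pointℤ → Pointℤ → Pointℤ → Bool
linking p q r s =
  (below p r s xor below q r s) xor ((below r p q xor below s p q)
    xor ((p ◁ r xor q ◁ r) xor (p ◁ s xor q ◁ s)))

linking-swapʳ : ∀ p q r s → linking p q s r ≡ linking p q r s
linking-swapʳ p q r s
  rewrite ∨-comm (belowʳ p s r) (belowʳ p r s)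
        | ∨-comm (belowʳ q s r) (belowʳ q r s)
        | xor-comm (below s p q) (below r p q)
        | xor-comm (p ◁ s xor q ◁ s) (p ◁ r xor q ◁ r)
  = refl

linking-swapˡ : ∀ p q r s → linking q p r s ≡ linking p q r s
linking-swapˡ p q r s
  rewrite ∨-comm (belowʳ r q p) (belowʳ r p q)
        | ∨-comm (belowʳ s q p) (belowʳ s p q)
        | xor-comm (below q r s) (below p r s)
        | xor-comm (q ◁ r) (p ◁ r)
        | xor-comm (q ◁ s) (p ◁ s)
  = refl

-- The `below` terms trade places, and each of the four comparisons is negated; four negations
-- cancel modulo 2.
linking-sym : ∀ p q r s → X p ≢ X r → X p ≢ X s → X q ≢ X r → X q ≢ X s →
  linking r s p q ≡ linking p q r s
linking-sym p q r s p≢r p≢s q≢r q≢s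
  = trans
      (cong (λ t → (below r p q xor below s p q) xor ((below p r s xor below q r s) xor t)) spans)
      (solve 5 (λ a b c d t → (a :+ b) :+ ((c :+ d) :+ t) := (c :+ d) :+ ((a :+ b) :+ t))
        refl (below r p q) (below s p q) (below p r s) (below q r s) _)
  where
  open xor-∧-Solver
  spans : (r ◁ p xor s ◁ p) xor (r ◁ q xor s ◁ q) ≡ (p ◁ r xor q ◁ r) xor (p ◁ s xor q ◁ s)
  spans = trans
    (solve 4 (λ e f g h → (e :+ f) :+ (g :+ h)
        := ((con true :+ e) :+ (con true :+ g)) :+ ((con true :+ f) :+ (con true :+ h)))
      refl (r ◁ p) (s ◁ p) (r ◁ q) (s ◁ q))
    (sym (cong₂ _xor_ (cong₂ _xor_ (◁-not p r p≢r) (◁-not q r q≢r))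
                      (cong₂ _xor_ (◁-not p s p≢s) (◁-not q s q≢s))))

-- With p left of r and r left of s, only the place of q is open. A sign change between the two ends
-- of the common range, or a zero at either, would give a common point.
linking-sorted : ∀ p q r s → X r < X s → X p < X r →
  X q ≢ X r → X q ≢ X s → ¬ Meets p q r s → linking p q r s ≡ false
linking-sorted p q r s r<s p<r q≢r q≢s ¬meets with <-cmp (X q) (X r) | <-cmp (X q) (X s)
... | tri≈ _ q≡r _ | _ = contradiction q≡r q≢r
... | _ | tri≈ _ q≡s _ = contradiction q≡s q≢s
... | tri< q<r _ _ | tri> _ _ s<q = contradiction (<-trans s<q q<r) (<-asym r<s)
-- The ranges are disjoint: no `below` holds, and all four comparisons do.
... | tri< q<r _ _ | tri< q<s _ _
  rewrite ◁-true p r p<r | ◁-false p r p<r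
        | ◁-true q r q<r | ◁-false q r q<r | ◁-true q s q<s | ◁-false q s q<s
        | ◁-true p s (<-trans p<r r<s) | ◁-false p s (<-trans p<r r<s) = refl
-- The common range runs from r to q. The comparisons sum to one, so exactly one of "r under pq" and
-- "q under rs" must hold.
... | tri> _ _ r<q | tri< q<s _ _
  rewrite ◁-true p r p<r | ◁-false p r p<r
        | ◁-true r q r<q | ◁-false r q r<q | ◁-true q s q<s | ◁-false q s q<s
        | ◁-true p s (<-trans p<r r<s) | ◁-false p s (<-trans p<r r<s)
  with <-cmp (orient p q r) 0ℤ | <-cmp (orient r s q) 0ℤ
... | tri≈ _ r0 _ | _ = contradiction (between-collinear-meets s p<r r<q r0) ¬meets
... | _ | tri≈ _ q0 _ =
  contradiction (meets-swapˡ (meets-sym (between-collinear-meets p r<q q<s q0))) ¬meets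
... | tri< r- _ _ | tri< q- _ _ =
  contradiction (overlapping-meets-below p<r r<q q<s (neg-mono-< r-) (neg-mono-< q-)) ¬meets
... | tri> _ _ r+ | tri> _ _ q+ = contradiction (overlapping-meets-above p<r r<q q<s r+ q+) ¬meets
... | tri< r- _ _ | tri> _ _ q+
  rewrite dec-true (orient p q r ℤ.<? 0ℤ) r- | dec-false (orient r s q ℤ.<? 0ℤ) (<-asym q+) = refl
... | tri> _ _ r+ | tri< q- _ _
  rewrite dec-true (orient r s q ℤ.<? 0ℤ) q- | dec-false (orient p q r ℤ.<? 0ℤ) (<-asym r+) = refl
-- The range of rs lies within that of pq. The comparisons cancel, so r and s must be on the same
-- side of pq.
linking-sorted p q r s r<s p<r q≢r q≢s ¬meets | tri> _ _ r<q | tri> _ _ s<q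
  rewrite ◁-true p r p<r | ◁-false p r p<r
        | ◁-true r q r<q | ◁-false r q r<q | ◁-true s q s<q | ◁-false s q s<q
        | ◁-true p s (<-trans p<r r<s) | ◁-false p s (<-trans p<r r<s)
  with <-cmp (orient p q r) 0ℤ | <-cmp (orient p q s) 0ℤ
... | tri≈ _ r0 _ | _ = contradiction (between-collinear-meets s p<r r<q r0) ¬meets
... | _ | tri≈ _ s0 _ = contradiction
  (meets-swapʳ (between-collinear-meets r (<-trans p<r r<s) s<q s0)) ¬meets
... | tri< r- _ _ | tri> _ _ s+ =
  contradiction (nested-meets p<r r<q (<-trans p<r r<s) s<q (neg-mono-< r-) s+) ¬meets
... | tri> _ _ r+ | tri< s- _ _ =
  contradiction (meets-swapʳ (nested-meets (<-trans p<r r<s) s<q p<r r<q (neg-mono-< s-) r+)) ¬meets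
... | tri< r- _ _ | tri< s- _ _
  rewrite dec-true (orient p q r ℤ.<? 0ℤ) r- | dec-true (orient p q s ℤ.<? 0ℤ) s- = refl
... | tri> _ _ r+ | tri> _ _ s+
  rewrite dec-false (orient p q r ℤ.<? 0ℤ) (<-asym r+)
        | dec-false (orient p q s ℤ.<? 0ℤ) (<-asym s+) = refl

linking-ascending : ∀ p q r s → X p < X q → X r < X s →
  X p ≢ X r → X p ≢ X s → X q ≢ X r → X q ≢ X s →
  ¬ Meets p q r s → linking p q r s ≡ false
linking-ascending p q r s p<q r<s p≢r p≢s q≢r q≢s ¬meets with <-cmp (X p) (X r)
... | tri< p<r _ _ = linking-sorted p q r s r<s p<r q≢r q≢s ¬meets
... | tri≈ _ p≡r _ = contradiction p≡r p≢r
... | tri> _ _ r<p = trans (sym (linking-sym p q r s p≢r p≢s q≢r q≢s))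
  (linking-sorted r s p q p<q r<p (p≢s ∘ sym) (q≢s ∘ sym) (¬meets ∘ meets-sym))

linking-disjoint : ∀ p q r s → X p ≢ X q → X r ≢ X s →
  X p ≢ X r → X p ≢ X s → X q ≢ X r → X q ≢ X s →
  ¬ Meets p q r s → linking p q r s ≡ false
linking-disjoint p q r s p≢q r≢s p≢r p≢s q≢r q≢s ¬meets
  with <-cmp (X p) (X q) | <-cmp (X r) (X s)
... | tri≈ _ p≡q _ | _ = contradiction p≡q p≢q
... | _ | tri≈ _ r≡s _ = contradiction r≡s r≢s
... | tri< p<q _ _ | tri< r<s _ _ = linking-ascending p q r s p<q r<s p≢r p≢s q≢r q≢s ¬meets
... | tri< p<q _ _ | tri> _ _ s<r = trans (sym (linking-swapʳ p q r s))
  (linking-ascending p q s r p<q s<r p≢s p≢r q≢s q≢r (¬meets ∘ meets-swapʳ))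
... | tri> _ _ q<p | tri< r<s _ _ = trans (sym (linking-swapˡ p q r s))
  (linking-ascending q p r s q<p r<s q≢r q≢s p≢r p≢s (¬meets ∘ meets-swapˡ))
... | tri> _ _ q<p | tri> _ _ s<r = trans
  (sym (trans (linking-swapˡ p q s r) (linking-swapʳ p q r s)))
  (linking-ascending q p s r q<p s<r q≢s q≢r p≢s p≢r (¬meets ∘ meets-swapˡ ∘ meets-swapʳ))

-- Cancellation modulo 2

module _ {A : Set} where

  parity : (A → Bool) → List A → Bool
  parity f = foldr (λ x b → f x xor b) false

  parity-++ : ∀ f xs ys → parity f (xs ++ ys) ≡ parity f xs xor parity f ys
  parity-++ f []       ys = refl
  parity-++ f (x ∷ xs) ys =
    trans (cong (f x xor_) (parity-++ f xs ys)) (sym (xor-assoc (f x) _ _))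

  module _ (_≟_ : DecidableEquality A) where

    toggle : A → List A → List A
    toggle x [] = x ∷ []
    toggle x (y ∷ ys) with x ≟ y
    ... | yes _ = ys
    ... | no  _ = y ∷ toggle x ys

    parity-toggle : ∀ f x xs → parity f (toggle x xs) ≡ f x xor parity f xs
    parity-toggle f x [] = refl
    parity-toggle f x (y ∷ ys) with x ≟ y
    ... | yes refl = sym (trans (sym (xor-assoc (f x) (f x) _)) (cong (_xor _) (xor-same (f x))))
    ... | no  _ = trans (cong (f y xor_) (parity-toggle f x ys))
        (solve 3 (λ a b c → a :+ (b :+ c) := b :+ (a :+ c)) refl (f y) (f x) _)
      where open xor-∧-Solver using (solve; _:=_; _:+_)

    -- A list stands for a formal sum over 𝔽₂, and this is its reduced form. On closed entries it
    -- evaluates, so identities between long sums hold by `refl`.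
    cancelPairs : List A → List A
    cancelPairs = foldr toggle []

    parity-cancelPairs : ∀ f xs → parity f (cancelPairs xs) ≡ parity f xs
    parity-cancelPairs f []       = refl
    parity-cancelPairs f (x ∷ xs) = trans (parity-toggle f x (cancelPairs xs))
      (cong (f x xor_) (parity-cancelPairs f xs))

-- Three consecutive triangles

-- Such a stack is the nested triangles graph on 9 vertices: 1, 2, 3 form A,
-- 4, 5, 6 form M and 7, 8, 9 form B.
Independent : ℕ × ℕ × ℕ × ℕ → Set
Independent (i , j , k , l) =
  NTAdj 9 i j × NTAdj 9 k l × i ≢ k × i ≢ l × j ≢ k × j ≢ l

isVertex? : ∀ n i → Dec (IsVertex n i)
isVertex? n i = 1 ℕ.≤? i ×-dec i ℕ.≤? n

adjacent? : ∀ n i j → Dec (NTAdj n i j)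
adjacent? n i j = isVertex? n i ×-dec isVertex? n j ×-dec
  ((¬? (i ℕ.≟ j) ×-dec block i ℕ.≟ block j) ⊎-dec (j ℕ.≟ i ℕ.+ 3 ⊎-dec i ℕ.≟ j ℕ.+ 3))

independent? : ∀ e → Dec (Independent e)
independent? (i , j , k , l) = adjacent? 9 i j ×-dec adjacent? 9 k l ×-dec
  ¬? (i ℕ.≟ k) ×-dec ¬? (i ℕ.≟ l) ×-dec ¬? (j ℕ.≟ k) ×-dec ¬? (j ℕ.≟ l)

adjacent⇒≢ : ∀ {n i j} → NTAdj n i j → i ≢ j
adjacent⇒≢ (_ , _ , inj₁ (i≢j , _))   refl = i≢j refl
adjacent⇒≢ (_ , _ , inj₂ (inj₁ i≡i+3)) refl = ℕ.m≢1+n+m _ (trans i≡i+3 (ℕ.+-comm _ 3))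
adjacent⇒≢ (_ , _ , inj₂ (inj₂ i≡i+3)) refl = ℕ.m≢1+n+m _ (trans i≡i+3 (ℕ.+-comm _ 3))

-- Distinct abscissae are the general position that `linking` needs; a grid drawing attains it only
-- after a shear.
record Stack (q : ℕ → Pointℤ) : Set where
  field
    distinct : ∀ {i j} → IsVertex 9 i → IsVertex 9 j → i ≢ j → X (q i) ≢ X (q j)
    disjoint : ∀ {i j k l} → Independent (i , j , k , l) → ¬ Meets (q i) (q j) (q k) (q l)

-- The unknowns of a linear system over 𝔽₂, with a constant.
Atom : Set
Atom = ⊤ ⊎ (ℕ × ℕ) ⊎ (ℕ × ℕ × ℕ)

pattern one           = inj₁ tt
pattern before i j    = inj₂ (inj₁ (i , j))
pattern under i j k   = inj₂ (inj₂ (i , j , k))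

_≟ᴬ_ : DecidableEquality Atom
_≟ᴬ_ = ⊎.≡-dec ⊤._≟_ (⊎.≡-dec (×.≡-dec ℕ._≟_ ℕ._≟_) (×.≡-dec ℕ._≟_ (×.≡-dec ℕ._≟_ ℕ._≟_)))

-- Expresses q i ◁ q j by the unknown with increasing indices.
precedes : ℕ → ℕ → List Atom
precedes i j with i ℕ.<? j
... | yes _ = before i j ∷ []
... | no  _ = one ∷ before j i ∷ []

linkingAtoms : ℕ × ℕ × ℕ × ℕ → List Atom
linkingAtoms (i , j , k , l) =
  under i k l ∷ under j k l ∷ under k i j ∷ under l i j ∷
  precedes i k ++ precedes j k ++ precedes i l ++ precedes j l

module _ {q : ℕ → Pointℤ} (stack : Stack q) where

  open Stack stack

  ⟦_⟧ : Atom → Bool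
  ⟦ one ⟧         = true
  ⟦ before i j ⟧  = q i ◁ q j
  ⟦ under i j k ⟧ = below (q i) (q j) (q k)

  parity-precedes : ∀ {i j} → X (q i) ≢ X (q j) → parity ⟦_⟧ (precedes i j) ≡ q i ◁ q j
  parity-precedes {i} {j} i≢j with i ℕ.<? j
  ... | yes _ = xor-identityʳ _
  ... | no  _ = trans (cong not (xor-identityʳ _)) (sym (◁-not (q i) (q j) i≢j))

  -- Each pair of independent edges contributes one homogeneous equation to the linear system.
  parity-linkingAtoms : ∀ e → Independent e → parity ⟦_⟧ (linkingAtoms e) ≡ false
  parity-linkingAtoms (i , j , k , l)
    ind@(ij@(vi , vj , _) , kl@(vk , vl , _) , i≢k , i≢l , j≢k , j≢l) =
    trans (cong (λ t → belowᵢ xor belowⱼ xor belowₖ xor belowₗ xor t)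
      (trans (parity-++ ⟦_⟧ (precedes i k) _) (cong₂ _xor_ (parity-precedes (distinct vi vk i≢k))
      (trans (parity-++ ⟦_⟧ (precedes j k) _) (cong₂ _xor_ (parity-precedes (distinct vj vk j≢k))
      (trans (parity-++ ⟦_⟧ (precedes i l) _) (cong₂ _xor_ (parity-precedes (distinct vi vl i≢l))
        (parity-precedes (distinct vj vl j≢l)))))))))
    (trans (regroup belowᵢ belowⱼ belowₖ belowₗ
                    (q i ◁ q k) (q j ◁ q k) (q i ◁ q l) (q j ◁ q l))
      (linking-disjoint (q i) (q j) (q k) (q l)
        (distinct vi vj (adjacent⇒≢ ij)) (distinct vk vl (adjacent⇒≢ kl))
        (distinct vi vk i≢k) (distinct vi vl i≢l) (distinct vj vk j≢k) (distinct vj vl j≢l)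
        (disjoint ind)))
    where
    belowᵢ = below (q i) (q k) (q l)
    belowⱼ = below (q j) (q k) (q l)
    belowₖ = below (q k) (q i) (q j)
    belowₗ = below (q l) (q i) (q j)
    open xor-∧-Solver using (solve; _:=_; _:+_)
    regroup : ∀ a b c d e f g h → a xor b xor c xor d xor e xor f xor g xor h
      ≡ (a xor b) xor ((c xor d) xor ((e xor f) xor (g xor h)))
    regroup = solve 8 (λ a b c d e f g h → a :+ (b :+ (c :+ (d :+ (e :+ (f :+ (g :+ h))))))
      := (a :+ b) :+ ((c :+ d) :+ ((e :+ f) :+ (g :+ h)))) refl

  parity-linkings : ∀ {es} → All Independent es → parity ⟦_⟧ (concatMap linkingAtoms es) ≡ false
  parity-linkings [] = refl
  parity-linkings {e ∷ es} (ind ∷ inds) = trans (parity-++ ⟦_⟧ (linkingAtoms e) _)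
    (cong₂ _xor_ (parity-linkingAtoms e ind) (parity-linkings inds))

  modulo-linkings : ∀ xs {es} → All Independent es →
    parity ⟦_⟧ xs ≡ parity ⟦_⟧ (cancelPairs _≟ᴬ_ (xs ++ concatMap linkingAtoms es))
  modulo-linkings xs {es} inds = sym (trans
    (parity-cancelPairs _≟ᴬ_ ⟦_⟧ (xs ++ concatMap linkingAtoms es))
    (trans (parity-++ ⟦_⟧ xs _)
      (trans (cong (parity ⟦_⟧ xs xor_) (parity-linkings inds)) (xor-identityʳ _))))

  -- Ray casting: a point is inside M when the vertical ray upwards from it meets an odd number of
  -- edges of M.
  insideAtoms : ℕ → List Atom
  insideAtoms i = under i 4 5 ∷ under i 4 6 ∷ under i 5 6 ∷ []

  inside : ℕ → Bool
  inside i = parity ⟦_⟧ (insideAtoms i)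

  -- With a = 1, 2, 3, m = 4, 5, 6, b = 7, 8, 9: for each choice of two indices
  -- i, j, three paths join mᵢ to mⱼ: the edge mᵢmⱼ, aᵢaⱼ via A, bᵢbⱼ via B.
  -- The pairs are the independent edges on two different paths, together with
  -- mᵢmⱼ and either of the edges aₖmₖ, mₖbₖ at the third index k.
  vanKampenPairs : List (ℕ × ℕ × ℕ × ℕ)
  vanKampenPairs = concatMap pairs ((1 , 2 , 3) ∷ (1 , 3 , 2) ∷ (2 , 3 , 1) ∷ [])
    where
    pairs : ℕ × ℕ × ℕ → List (ℕ × ℕ × ℕ × ℕ)
    pairs (i , j , k) = let i' = 3 ℕ.+ i ; j' = 3 ℕ.+ j ; k' = 3 ℕ.+ k
                            i'' = 6 ℕ.+ i ; j'' = 6 ℕ.+ j ; k'' = 6 ℕ.+ k in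
      (i , j , i' , j') ∷ (k , k' , i' , j') ∷
      (i' , j' , i'' , j'') ∷ (i' , j' , k' , k'') ∷
      (i , j , i'' , j'') ∷ (i , j , i' , i'') ∷ (i , j , j' , j'') ∷
      (i , i' , i'' , j'') ∷ (i , i' , j' , j'') ∷
      (j , j' , i'' , j'') ∷ (j , j' , i' , i'') ∷ []

  -- Around the closed triangle M, everything that belongs to a single vertex of M occurs twice.
  -- What stays says that i and j are both inside M or both outside.
  middlePairs : ℕ → ℕ → List (ℕ × ℕ × ℕ × ℕ)
  middlePairs i j = (i , j , 4 , 5) ∷ (i , j , 4 , 6) ∷ (i , j , 5 , 6) ∷ []

  inside-xor : ∀ i j {es b} → All Independent es →
    parity ⟦_⟧ (cancelPairs _≟ᴬ_
      ((insideAtoms i ++ insideAtoms j) ++ concatMap linkingAtoms es)) ≡ b →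
    inside i xor inside j ≡ b
  inside-xor i j ind eq = trans (sym (parity-++ ⟦_⟧ (insideAtoms i) (insideAtoms j)))
    (trans (modulo-linkings (insideAtoms i ++ insideAtoms j) ind) eq)

  inside₁-xor-inside₂ : inside 1 xor inside 2 ≡ false
  inside₁-xor-inside₂ = inside-xor 1 2 (from-yes (All.all? independent? (middlePairs 1 2))) refl

  inside₁-xor-inside₃ : inside 1 xor inside 3 ≡ false
  inside₁-xor-inside₃ = inside-xor 1 3 (from-yes (All.all? independent? (middlePairs 1 3))) refl

  inside₇-xor-inside₈ : inside 7 xor inside 8 ≡ false
  inside₇-xor-inside₈ = inside-xor 7 8 (from-yes (All.all? independent? (middlePairs 7 8))) refl

  inside₇-xor-inside₉ : inside 7 xor inside 9 ≡ false
  inside₇-xor-inside₉ = inside-xor 7 9 (from-yes (All.all? independent? (middlePairs 7 9))) refl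

  -- The van Kampen pairs leave the `inside` parities of all six vertices of A and B and a constant.
  -- The `middlePairs` merge these into one parity for A and one for B; the constant `one` that
  -- survives makes their sum odd.
  inside₁-xor-inside₇ : inside 1 xor inside 7 ≡ true
  inside₁-xor-inside₇ = inside-xor 1 7 (from-yes (All.all? independent?
    (vanKampenPairs ++ middlePairs 1 2 ++ middlePairs 1 3
                    ++ middlePairs 7 8 ++ middlePairs 7 9))) refl

-- Heights of triangles

-- With q to the left of p and r to the right, both coefficients of the height differences are
-- positive.
orient-heights : ∀ p q r → orient q r p ≡ (X r - X p) * (Y p - Y q) + (X p - X q) * (Y p - Y r)
orient-heights (a , b) (c , d) (e , f) = eq a b c d e f
  where
  eq : ∀ a b c d e f → (e - c) * (b - d) - (f - d) * (a - c)
                     ≡ (e - a) * (b - d) + (a - c) * (b - f)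
  eq = solve-∀

orient-depths : ∀ p q r → (X r - X p) * (Y q - Y p) + (X p - X q) * (Y r - Y p) ≡ - orient q r p
orient-depths (a , b) (c , d) (e , f) = eq a b c d e f
  where
  eq : ∀ a b c d e f → (e - a) * (d - b) + (a - c) * (f - b)
                     ≡ - ((e - c) * (b - d) - (f - d) * (a - c))
  eq = solve-∀

0≤-* : ∀ {i j} → 0ℤ ≤ i → 0ℤ ≤ j → 0ℤ ≤ i * j
0≤-* {i} {j} 0≤i 0≤j =
  subst (_≤ i * j) (*-zeroʳ i) (*-monoˡ-≤-nonNeg i {{ℤ.nonNegative 0≤i}} 0≤j)

belowʳ-true : ∀ p q r → belowʳ p q r ≡ true → X q < X p × X p < X r × orient q r p < 0ℤ
belowʳ-true p q r eq with X q ℤ.<? X p | X p ℤ.<? X r | orient q r p ℤ.<? 0ℤ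
... | yes q<p | yes p<r | yes o = q<p , p<r , o

-- A point at least as high as both ends would make both products in `orient-heights` nonnegative.
belowʳ-height : ∀ p q r → belowʳ p q r ≡ true → Y p < Y q ⊔ Y r
belowʳ-height p q r eq with belowʳ-true p q r eq
... | q<p , p<r , o = ≰⇒> λ max≤p → <⇒≱ o (subst (0ℤ ≤_) (sym (orient-heights p q r)) (+-mono-≤
  (0≤-* (<⇒≤ (i<j⇒0<j-i p<r)) (i≤j⇒0≤j-i (≤-trans (i≤i⊔j (Y q) (Y r)) max≤p)))
  (0≤-* (<⇒≤ (i<j⇒0<j-i q<p)) (i≤j⇒0≤j-i (≤-trans (i≤j⊔i (Y q) (Y r)) max≤p)))))

below-height : ∀ p q r → below p q r ≡ true → Y p < Y q ⊔ Y r
below-height p q r eq with belowʳ p q r in eqʳ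
... | true  = belowʳ-height p q r eqʳ
... | false = subst (Y p <_) (⊔-comm (Y r) (Y q)) (belowʳ-height p r q eq)

between-height : ∀ p q r → X q < X p → X p < X r → below p q r ≡ false → Y q ⊓ Y r ≤ Y p
between-height p q r q<p p<r eq = ≮⇒≥ λ p<min → contradiction (trans (sym eq) (hit p<min)) λ ()
  where
  hit : Y p < Y q ⊓ Y r → below p q r ≡ true
  hit p<min rewrite ◁-true q p q<p | ◁-true p r p<r
    | dec-true (orient q r p ℤ.<? 0ℤ) (neg-cancel-< (subst (0ℤ <_) (orient-depths p q r)
        (0<-+ (0<-* (i<j⇒0<j-i p<r) (i<j⇒0<j-i (<-≤-trans p<min (i⊓j≤i (Y q) (Y r)))))
              (0<-* (i<j⇒0<j-i q<p) (i<j⇒0<j-i (<-≤-trans p<min (i⊓j≤j (Y q) (Y r)))))))) = refl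

-- For distinct abscissae: the vertical line through p separates q from r.
span : Pointℤ → Pointℤ → Pointℤ → Bool
span p q r = (q ◁ p) xor (r ◁ p)

span-height : ∀ p q r → X p ≢ X q → X p ≢ X r →
  span p q r ≡ true → below p q r ≡ false → Y q ⊓ Y r ≤ Y p
span-height p q r p≢q p≢r spans above with <-cmp (X p) (X q) | <-cmp (X p) (X r)
... | tri≈ _ p≡q _ | _ = contradiction p≡q p≢q
... | _ | tri≈ _ p≡r _ = contradiction p≡r p≢r
... | tri> _ _ q<p | tri< p<r _ _ = between-height p q r q<p p<r above
... | tri< p<q _ _ | tri> _ _ r<p = subst (_≤ Y p) (⊓-comm (Y r) (Y q))
  (between-height p r q r<p p<q (trans (∨-comm (belowʳ p r q) _) above))
... | tri< p<q _ _ | tri< p<r _ _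
  rewrite ◁-false p q p<q | ◁-false p r p<r = contradiction spans λ ()
... | tri> _ _ q<p | tri> _ _ r<p
  rewrite ◁-true q p q<p | ◁-true r p r<p = contradiction spans λ ()

below⇒span : ∀ p q r → below p q r ≡ true → span p q r ≡ true
below⇒span p q r eq with belowʳ p q r in eqʳ
... | true = let q<p , p<r , _ = belowʳ-true p q r eqʳ in
  cong₂ _xor_ (◁-true q p q<p) (◁-false p r p<r)
... | false = let r<p , p<q , _ = belowʳ-true p r q eq in
  cong₂ _xor_ (◁-false p q p<q) (◁-true r p r<p)

-- Used with a `below` and its `span`: either the edge crosses the vertical line of p without lying
-- above p, or the two agree.
implied⇒less⊎equal : ∀ a x → (a ≡ true → x ≡ true) → (x ≡ true × a ≡ false) ⊎ a ≡ x
implied⇒less⊎equal true  x     a⇒x = inj₂ (sym (a⇒x refl))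
implied⇒less⊎equal false true  _   = inj₁ (refl , refl)
implied⇒less⊎equal false false _   = inj₂ refl

top bottom spread : Pointℤ → Pointℤ → Pointℤ → ℤ
top    p q r = Y p ⊔ Y q ⊔ Y r
bottom p q r = Y p ⊓ Y q ⊓ Y r
spread p q r = top p q r - bottom p q r

module _ (p q r s : Pointℤ)
  (odd : below p q r xor below p q s xor below p r s xor false ≡ true) where

  odd⇒<top : Y p < top q r s
  odd⇒<top with below p q r in e₁ | below p q s in e₂ | below p r s in e₃
  ... | true | _ | _ = <-≤-trans (below-height p q r e₁) (i≤i⊔j _ (Y s))
  ... | false | true | _ = <-≤-trans (below-height p q s e₂)
    (⊔-monoˡ-≤ (Y s) (i≤i⊔j (Y q) (Y r)))
  ... | false | false | true = <-≤-trans (below-height p r s e₃)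
    (⊔-monoˡ-≤ (Y s) (i≤j⊔i (Y q) (Y r)))
  ... | false | false | false = contradiction odd λ ()

  -- A vertical line separates the ends of an even number of edges of a triangle. As an odd number
  -- lies above p, some edge crosses the line without lying above p, and its lower end is no higher
  -- than p.
  odd⇒≥bottom : X p ≢ X q → X p ≢ X r → X p ≢ X s → bottom q r s ≤ Y p
  odd⇒≥bottom p≢q p≢r p≢s
    with implied⇒less⊎equal _ (span p q r) (below⇒span p q r)
       | implied⇒less⊎equal _ (span p q s) (below⇒span p q s)
       | implied⇒less⊎equal _ (span p r s) (below⇒span p r s)
  ... | inj₁ (t , f) | _ | _ =
    ≤-trans (i⊓j≤i _ (Y s)) (span-height p q r p≢q p≢r t f)
  ... | _ | inj₁ (t , f) | _ =
    ≤-trans (⊓-monoˡ-≤ (Y s) (i⊓j≤i (Y q) (Y r))) (span-height p q s p≢q p≢s t f)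
  ... | _ | _ | inj₁ (t , f) =
    ≤-trans (⊓-monoˡ-≤ (Y s) (i⊓j≤j (Y q) (Y r))) (span-height p r s p≢r p≢s t f)
  ... | inj₂ e₁ | inj₂ e₂ | inj₂ e₃ = contradiction
    (trans (sym odd) (trans (cong₂ _xor_ e₁ (cong₂ _xor_ e₂ (cong (_xor false) e₃)))
      (solve 3 (λ a b c → (a :+ b) :+ ((a :+ c) :+ ((b :+ c) :+ con false)) := con false) refl
        (q ◁ p) (r ◁ p) (s ◁ p)))) λ ()
    where open xor-∧-Solver

⊔-lub-< : ∀ {i j k} → i < k → j < k → i ⊔ j < k
⊔-lub-< {i} {j} {k} i<k j<k with ⊔-sel i j
... | inj₁ eq = subst (_< k) (sym eq) i<k
... | inj₂ eq = subst (_< k) (sym eq) j<k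

spreadAt : (ℕ → Pointℤ) → ℕ → ℤ
spreadAt q i = spread (q i) (q (suc i)) (q (2 ℕ.+ i))

module _ {q : ℕ → Pointℤ} (stack : Stack q) where

  open Stack stack

  OffMiddle : ℕ → Set
  OffMiddle i = IsVertex 9 i × i ≢ 4 × i ≢ 5 × i ≢ 6

  offMiddle? : ∀ i → Dec (OffMiddle i)
  offMiddle? i = isVertex? 9 i ×-dec ¬? (i ℕ.≟ 4) ×-dec ¬? (i ℕ.≟ 5) ×-dec ¬? (i ℕ.≟ 6)

  inside⇒<top×≥bottom : ∀ {i} → OffMiddle i → inside stack i ≡ true →
    Y (q i) < top (q 4) (q 5) (q 6) × bottom (q 4) (q 5) (q 6) ≤ Y (q i)
  inside⇒<top×≥bottom {i} (v , i≢4 , i≢5 , i≢6) odd =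
    odd⇒<top (q i) (q 4) (q 5) (q 6) odd ,
    odd⇒≥bottom (q i) (q 4) (q 5) (q 6) odd
      (distinct v (from-yes (isVertex? 9 4)) i≢4)
      (distinct v (from-yes (isVertex? 9 5)) i≢5)
      (distinct v (from-yes (isVertex? 9 6)) i≢6)

  spread-inside : ∀ {i j k} → OffMiddle i × OffMiddle j × OffMiddle k →
    inside stack i ≡ true →
    inside stack i xor inside stack j ≡ false → inside stack i xor inside stack k ≡ false →
    spread (q i) (q j) (q k) < spreadAt q 4
  spread-inside (oi , oj , ok) in-i i-j i-k
    with inside⇒<top×≥bottom oi in-i
       | inside⇒<top×≥bottom oj (transfer in-i i-j)
       | inside⇒<top×≥bottom ok (transfer in-i i-k)
    where
    transfer : ∀ {a b} → a ≡ true → a xor b ≡ false → b ≡ true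
    transfer {b = true}  _    _ = refl
    transfer {b = false} refl ()
  ... | <i , ≥i | <j , ≥j | <k , ≥k =
    -- Strictness at the top alone already makes the spread smaller.
    +-mono-<-≤ (⊔-lub-< (⊔-lub-< <i <j) <k) (neg-mono-≤ (⊓-glb (⊓-glb ≥i ≥j) ≥k))

  middle-spread-exceeds : spreadAt q 1 < spreadAt q 4 ⊎ spreadAt q 7 < spreadAt q 4
  middle-spread-exceeds with inside stack 1 in in₁ | inside stack 7 in in₇
  ... | true  | _     = inj₁ (spread-inside
    (from-yes (offMiddle? 1 ×-dec offMiddle? 2 ×-dec offMiddle? 3))
    in₁ (inside₁-xor-inside₂ stack) (inside₁-xor-inside₃ stack))
  ... | _     | true  = inj₂ (spread-inside
    (from-yes (offMiddle? 7 ×-dec offMiddle? 8 ×-dec offMiddle? 9))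
    in₇ (inside₇-xor-inside₈ stack) (inside₇-xor-inside₉ stack))
  ... | false | false = contradiction
    (trans (sym (inside₁-xor-inside₇ stack)) (cong₂ _xor_ in₁ in₇)) λ ()

-- From the drawing story to integer stacks

-- In unnormalised rationals the equation is a cross multiplication, hence an identity of integers.
interpolate : ∀ α β m p q → α + β ≡ + suc m →
  toℚ p ℚ.+ β ℚ./ suc m ℚ.* (toℚ q ℚ.- toℚ p) ≡ (α * p + β * q) ℚ./ suc m
interpolate α β m p q α+β≡ = ℚ.toℚᵘ-injective (begin
  toℚᵘ (toℚ p ℚ.+ β ℚ./ suc m ℚ.* (toℚ q ℚ.- toℚ p))
    ≈⟨ ℚ.toℚᵘ-homo-+ (toℚ p) _ ⟩
  toℚᵘ (toℚ p) ℚᵘ.+ toℚᵘ (β ℚ./ suc m ℚ.* (toℚ q ℚ.- toℚ p))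
    ≈⟨ ℚᵘ.+-cong (value p 0)
         (ℚᵘ.≃-trans (ℚ.toℚᵘ-homo-* (β ℚ./ suc m) _) (ℚᵘ.*-cong (value β m) difference)) ⟩
  mkℚᵘ p 0 ℚᵘ.+ mkℚᵘ β m ℚᵘ.* (mkℚᵘ q 0 ℚᵘ.- mkℚᵘ p 0)
    ≈⟨ *≡* equation ⟩
  mkℚᵘ (α * p + β * q) m
    ≈⟨ value (α * p + β * q) m ⟨
  toℚᵘ ((α * p + β * q) ℚ./ suc m) ∎)
  where
  open import Relation.Binary.Reasoning.Setoid ℚᵘ.≃-setoid
  value : ∀ i d → toℚᵘ (i ℚ./ suc d) ℚᵘ.≃ mkℚᵘ i d
  value i d = ℚ.toℚᵘ-fromℚᵘ (mkℚᵘ i d)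
  difference : toℚᵘ (toℚ q ℚ.- toℚ p) ℚᵘ.≃ mkℚᵘ q 0 ℚᵘ.- mkℚᵘ p 0
  difference = ℚᵘ.≃-trans (ℚ.toℚᵘ-homo-+ (toℚ q) _)
    (ℚᵘ.+-cong (value q 0) (ℚᵘ.≃-trans (ℚ.toℚᵘ-homo‿- (toℚ p)) (ℚᵘ.-‿cong (value p 0))))
  -- d, e and f are the denominator m + 1 in the three forms in which the arithmetic of fractions
  -- writes it.
  ring : ∀ α β p q {d e f} → α + β ≡ d → e ≡ d → f ≡ d →
    (p * e + β * (q * + 1 + - p * + 1) * + 1) * d ≡ (α * p + β * q) * f
  ring α β p q refl refl refl = eq α β p q
    where
    eq : ∀ α β p q → (p * (α + β) + β * (q * + 1 + - p * + 1) * + 1) * (α + β)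
                   ≡ (α * p + β * q) * (α + β)
    eq = solve-∀
  equation = ring α β p q α+β≡
    (cong (λ k → + suc k) (ℕ.*-identityʳ m))
    (cong (λ k → + suc k) (trans (ℕ.+-identityʳ (m ℕ.* 1)) (ℕ.*-identityʳ m)))

meets⇒common : ∀ {p q r s} → Meets p q r s →
  ∃[ z ] OnSegment z (embed p) (embed q) × OnSegment z (embed r) (embed s)
meets⇒common {p} {q} {r} {s} record
    { α = α ; β = β ; γ = γ ; δ = δ ; 0≤α = 0≤α ; 0≤β = 0≤β ; 0≤γ = 0≤γ ; 0≤δ = 0≤δ
    ; 0<α+β = 0<α+β ; α+β≡γ+δ = α+β≡γ+δ ; X-common = X-common ; Y-common = Y-common }
  with α + β in α+β≡ | 0<α+β
... | ℤ.+0       | ℤ.+<+ ()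
-- The total weight, common to both segments, becomes the denominator.
... | ℤ.+[1+ m ] | _ =
  ((α * X p + β * X q) ℚ./ suc m , (α * Y p + β * Y q) ℚ./ suc m) ,
  (β ℚ./ suc m , 0≤weight β 0≤β , weight≤1 α β 0≤α α+β≡ ,
    sym (interpolate α β m (X p) (X q) α+β≡) , sym (interpolate α β m (Y p) (Y q) α+β≡)) ,
  (δ ℚ./ suc m , 0≤weight δ 0≤δ , weight≤1 γ δ 0≤γ (sym α+β≡γ+δ) ,
    trans (cong (ℚ._/ suc m) X-common) (sym (interpolate γ δ m (X r) (X s) (sym α+β≡γ+δ))) ,
    trans (cong (ℚ._/ suc m) Y-common) (sym (interpolate γ δ m (Y r) (Y s) (sym α+β≡γ+δ))))
  where
  0≤weight : ∀ β → 0ℤ ≤ β → 0ℚ ℚ.≤ β ℚ./ suc m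
  0≤weight β 0≤β = ℚ.toℚᵘ-cancel-≤ (ℚᵘ.≤-respʳ-≃ (ℚᵘ.≃-sym (ℚ.toℚᵘ-fromℚᵘ (mkℚᵘ β m)))
    (*≤* (subst (0ℤ ≤_) (sym (*-identityʳ β)) 0≤β)))
  weight≤1 : ∀ α β → 0ℤ ≤ α → α + β ≡ + suc m → β ℚ./ suc m ℚ.≤ 1ℚ
  weight≤1 α β 0≤α eq = ℚ.toℚᵘ-cancel-≤ (ℚᵘ.≤-respˡ-≃ (ℚᵘ.≃-sym (ℚ.toℚᵘ-fromℚᵘ (mkℚᵘ β m)))
    (*≤* (subst₂ _≤_ (sym (*-identityʳ β)) (trans eq (sym (*-identityˡ (+ suc m))))
      (subst (_≤ α + β) (+-identityˡ β) (+-monoˡ-≤ β 0≤α)))))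

-- For N larger than all differences of ordinates, shear N makes abscissae
-- distinct.
shear : ℤ → Pointℤ → Pointℤ
shear N (x , y) = N * x + y , y

-- Subtracting the second sheared equation from the first leaves N times the original one, and N
-- cancels.
meets-unshear : ∀ N {p q r s} → .{{_ : ℤ.NonZero N}} →
  Meets (shear N p) (shear N q) (shear N r) (shear N s) → Meets p q r s
meets-unshear N {p} {q} {r} {s} m = record
  { 0≤α = 0≤α ; 0≤β = 0≤β ; 0≤γ = 0≤γ ; 0≤δ = 0≤δ ; 0<α+β = 0<α+β ; α+β≡γ+δ = α+β≡γ+δ
  ; X-common = *-cancelˡ-≡ N _ _ (trans (eq N α β (X p) (Y p) (X q) (Y q))
      (trans (cong₂ _-_ X-common Y-common) (sym (eq N γ δ (X r) (Y r) (X s) (Y s)))))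
  ; Y-common = Y-common
  }
  where
  open Meets m
  eq : ∀ N α β a b c d → N * (α * a + β * c) ≡ α * (N * a + b) + β * (N * c + d) - (α * b + β * d)
  eq = solve-∀

-- Integer abscissae differ by at least one, which gains 1 + (d - c) and outweighs a loss of at most
-- d - c in the ordinate.
shear-mono-< : ∀ {c d} p q → c ≤ d → Y p ≤ d → c ≤ Y q → X p < X q →
  X (shear (1ℤ + (d - c)) p) < X (shear (1ℤ + (d - c)) q)
shear-mono-< {c} {d} p q c≤d p≤d c≤q p<q = 0<j-i⇒i<j (subst (0ℤ <_)
  (eq c d (X p) (Y p) (X q) (Y q))
  (+-mono-<-≤ {0ℤ} {1ℤ} (ℤ.+<+ (s≤s z≤n))
    (+-mono-≤
      (0≤-* (+-mono-≤ {0ℤ} {1ℤ} (ℤ.+≤+ z≤n) (i≤j⇒0≤j-i c≤d)) (i≤j⇒0≤j-i (i<j⇒suc[i]≤j p<q)))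
      (+-mono-≤ (i≤j⇒0≤j-i c≤q) (i≤j⇒0≤j-i p≤d)))))
  where
  eq : ∀ c d x y z w → 1ℤ + ((1ℤ + (d - c)) * (z - (1ℤ + x)) + ((w - c) + (d - y)))
    ≡ (1ℤ + (d - c)) * z + w - ((1ℤ + (d - c)) * x + y)
  eq = solve-∀

shear-distinct : ∀ {c d} p q → c ≤ d → c ≤ Y p × Y p ≤ d → c ≤ Y q × Y q ≤ d → p ≢ q →
  X (shear (1ℤ + (d - c)) p) ≢ X (shear (1ℤ + (d - c)) q)
shear-distinct {c} {d} p q c≤d (c≤p , p≤d) (c≤q , q≤d) p≢q e with <-cmp (X p) (X q)
... | tri< p<q _ _ = <-irrefl e (shear-mono-< p q c≤d p≤d c≤q p<q)
... | tri> _ _ q<p = <-irrefl (sym e) (shear-mono-< q p c≤d q≤d c≤p q<p)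
... | tri≈ _ x≡ _ = p≢q (cong₂ _,_ x≡
  (∙-cancelˡ (N * X q) _ _ (trans (cong (λ x → N * x + Y p) (sym x≡)) e)))
  where N = 1ℤ + (d - c)

-- The nine vertices after the first k triangles, renumbered from 1. With the offset on the right, 4
-- + k * 3 and 1 + (1 + k) * 3 agree by computation.
stackAt : (ℕ → Pointℤ) → ℕ → ℕ → Pointℤ
stackAt P k i = P (i ℕ.+ k ℕ.* 3)

-- This extract of planarity is symmetric in the two coordinates, so one bound serves for height and
-- width.
record DrawnStacks (n : ℕ) (P : ℕ → Pointℤ) : Set where
  field
    distinct : ∀ {i j} k → 9 ℕ.+ k ℕ.* 3 ℕ.≤ n → IsVertex 9 i → IsVertex 9 j → i ≢ j →
      stackAt P k i ≢ stackAt P k j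
    disjoint : ∀ {h i j l} k → 9 ℕ.+ k ℕ.* 3 ℕ.≤ n → Independent (h , i , j , l) →
      ¬ Meets (stackAt P k h) (stackAt P k i) (stackAt P k j) (stackAt P k l)

block-shift : ∀ i k → 1 ℕ.≤ i → block (i ℕ.+ k ℕ.* 3) ≡ block i ℕ.+ k
block-shift (suc i) k _ = trans (+-distrib-/-∣ʳ i {k ℕ.* 3} {3} (divides-refl k))
  (cong (i ℕ./ 3 ℕ.+_) (m*n/n≡m k 3))

isVertex-shift : ∀ {n i} k → 9 ℕ.+ k ℕ.* 3 ℕ.≤ n → IsVertex 9 i → IsVertex n (i ℕ.+ k ℕ.* 3)
isVertex-shift k fits (1≤i , i≤9) =
  ℕ.≤-trans 1≤i (ℕ.m≤m+n _ (k ℕ.* 3)) , ℕ.≤-trans (ℕ.+-monoˡ-≤ (k ℕ.* 3) i≤9) fits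

adjacent-shift : ∀ {n i j} k → 9 ℕ.+ k ℕ.* 3 ℕ.≤ n → NTAdj 9 i j →
  NTAdj n (i ℕ.+ k ℕ.* 3) (j ℕ.+ k ℕ.* 3)
adjacent-shift {i = i} {j} k fits (vi , vj , adj) =
  isVertex-shift k fits vi , isVertex-shift k fits vj , ⊎.map
    (λ (i≢j , same) → i≢j ∘ ℕ.+-cancelʳ-≡ (k ℕ.* 3) i j ,
      trans (block-shift i k (proj₁ vi))
        (trans (cong (ℕ._+ k) same) (sym (block-shift j k (proj₁ vj)))))
    (⊎.map
      (λ e → trans (cong (ℕ._+ k ℕ.* 3) e) (swap i))
      (λ e → trans (cong (ℕ._+ k ℕ.* 3) e) (swap j)))
    adj
  where
  swap : ∀ i → i ℕ.+ 3 ℕ.+ k ℕ.* 3 ≡ i ℕ.+ k ℕ.* 3 ℕ.+ 3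
  swap i = trans (ℕ.+-assoc i 3 _) (trans (cong (i ℕ.+_) (ℕ.+-comm 3 _)) (sym (ℕ.+-assoc i _ 3)))

story⇒drawnStacks : ∀ {n P} → PlanarGridDrawingStory n 9 P → DrawnStacks n P
story⇒drawnStacks {n} {P} story = record
  { distinct = λ {i} {j} k fits vi vj i≢j → proj₁ (planar k fits) _ _
      (window k fits vi) (window k fits vj) (i≢j ∘ ℕ.+-cancelʳ-≡ (k ℕ.* 3) i j)
  ; disjoint = λ k fits ind meets → crossing-free k fits ind (meets⇒common meets)
  }
  where
  planar : ∀ k → 9 ℕ.+ k ℕ.* 3 ℕ.≤ n → _
  -- At time 9 + 3k the window of size 9 shows exactly the vertices 3k + 1 to 3k + 9.
  planar k fits = story (9 ℕ.+ k ℕ.* 3) (s≤s z≤n) (ℕ.≤-trans fits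
    (ℕ.≤-trans (ℕ.m≤m+n n 8) (ℕ.≤-reflexive (sym (cong (ℕ._∸ 1) (ℕ.+-suc n 8))))))
  window : ∀ {i} k → 9 ℕ.+ k ℕ.* 3 ℕ.≤ n → IsVertex 9 i →
    InWindow n 9 (9 ℕ.+ k ℕ.* 3) (i ℕ.+ k ℕ.* 3)
  window {i} k fits v@(1≤i , i≤9) = isVertex-shift k fits v , ℕ.+-monoˡ-≤ (k ℕ.* 3) i≤9 ,
    ℕ.≤-trans (ℕ.≤-reflexive (ℕ.+-comm 10 (k ℕ.* 3)))
      (ℕ.≤-trans (ℕ.≤-reflexive (ℕ.+-suc _ 9))
        (ℕ.+-monoˡ-≤ 9 (ℕ.+-monoˡ-≤ (k ℕ.* 3) 1≤i)))
  crossing-free : ∀ {h i j l} k → 9 ℕ.+ k ℕ.* 3 ℕ.≤ n → Independent (h , i , j , l) →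
    ¬ (∃[ z ] OnSegment z (embed (stackAt P k h)) (embed (stackAt P k i))
            × OnSegment z (embed (stackAt P k j)) (embed (stackAt P k l)))
  crossing-free {h} {i} {j} {l} k fits
    (hi@(vh , vi , _) , jl@(vj , vl , _) , h≢j , h≢l , i≢j , i≢l) (z , on₁ , on₂)
    with proj₂ (proj₂ (planar k fits)) _ _ _ _
      (window k fits vh) (window k fits vi) (window k fits vj) (window k fits vl)
      (adjacent-shift k fits hi) (adjacent-shift k fits jl)
      (shifted h≢j ∘ proj₁) (shifted h≢l ∘ proj₁) z on₁ on₂
    where
    shifted : ∀ {i j} → i ≢ j → i ℕ.+ k ℕ.* 3 ≢ j ℕ.+ k ℕ.* 3
    shifted {i} {j} i≢j = i≢j ∘ ℕ.+-cancelʳ-≡ (k ℕ.* 3) i j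
  -- Planarity allows a common point only at a shared end, and independent edges share none.
  ... | a , inj₁ a≡h , inj₁ a≡j , _ = h≢j (ℕ.+-cancelʳ-≡ (k ℕ.* 3) h j (trans (sym a≡h) a≡j))
  ... | a , inj₁ a≡h , inj₂ a≡l , _ = h≢l (ℕ.+-cancelʳ-≡ (k ℕ.* 3) h l (trans (sym a≡h) a≡l))
  ... | a , inj₂ a≡i , inj₁ a≡j , _ = i≢j (ℕ.+-cancelʳ-≡ (k ℕ.* 3) i j (trans (sym a≡i) a≡j))
  ... | a , inj₂ a≡i , inj₂ a≡l , _ = i≢l (ℕ.+-cancelʳ-≡ (k ℕ.* 3) i l (trans (sym a≡i) a≡l))

-- Sequences without valleys

module _ (h : ℕ → ℕ) (H m : ℕ) (bounded : ∀ k → k ℕ.< m → h k ℕ.≤ H)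
  (no-valley : ∀ k → 2 ℕ.+ k ℕ.< m → h k ℕ.< h (1 ℕ.+ k) ⊎ h (2 ℕ.+ k) ℕ.< h (1 ℕ.+ k)) where

  -- While the values climb, each step gains at least one. When the climb stops, the index and the
  -- value are each at most H; afterwards each step adds one to the index and takes at least one
  -- from the value.
  rising⊎falling : ∀ k → suc k ℕ.< m →
    k ℕ.< h (suc k) ⊎ (¬ h k ℕ.< h (suc k) × k ℕ.+ h (suc k) ℕ.≤ H ℕ.+ H)
  rising⊎falling zero 1<m with h 0 ℕ.<? h 1
  ... | yes h₀<h₁ = inj₁ (ℕ.≤-trans (s≤s z≤n) h₀<h₁)
  ... | no  h₀≮h₁ = inj₂ (h₀≮h₁ , ℕ.≤-trans (bounded 1 1<m) (ℕ.m≤m+n H H))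
  rising⊎falling (suc k) k+2<m with rising⊎falling k (ℕ.<-trans (ℕ.n<1+n _) k+2<m)
  ... | inj₂ (not-rise , small) with no-valley k k+2<m
  ...   | inj₁ rise = contradiction rise not-rise
  ...   | inj₂ fall = inj₂ (ℕ.<-asym fall ,
    ℕ.≤-trans (ℕ.≤-reflexive (sym (ℕ.+-suc k _))) (ℕ.≤-trans (ℕ.+-monoʳ-≤ k fall) small))
  rising⊎falling (suc k) k+2<m | inj₁ large with h (suc k) ℕ.<? h (2 ℕ.+ k)
  ... | yes rise = inj₁ (ℕ.≤-<-trans large rise)
  ... | no  stop = inj₂ (stop , ℕ.+-mono-≤
    (ℕ.≤-trans large (bounded (suc k) (ℕ.<-trans (ℕ.n<1+n _) k+2<m))) (bounded (2 ℕ.+ k) k+2<m))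

-- At the last index k = m - 2 either alternative gives k ≤ H + H.
no-valley⇒short : ∀ h H m → (∀ k → k ℕ.< m → h k ℕ.≤ H) →
  (∀ k → 2 ℕ.+ k ℕ.< m → h k ℕ.< h (1 ℕ.+ k) ⊎ h (2 ℕ.+ k) ℕ.< h (1 ℕ.+ k)) →
  m ℕ.≤ 2 ℕ.+ (H ℕ.+ H)
no-valley⇒short h H 0 _ _ = z≤n
no-valley⇒short h H 1 _ _ = s≤s z≤n
no-valley⇒short h H (suc (suc k)) bounded no-valley
  with rising⊎falling h H (2 ℕ.+ k) bounded no-valley k ℕ.≤-refl
... | inj₁ large = s≤s (s≤s (ℕ.≤-trans (ℕ.<⇒≤ large)
  (ℕ.≤-trans (bounded (suc k) ℕ.≤-refl) (ℕ.m≤m+n H H))))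
... | inj₂ (_ , small) = s≤s (s≤s (ℕ.≤-trans (ℕ.m≤m+n k _) small))

-- Bounds for the whole drawing

module _ {n P c d} (drawn : DrawnStacks n P) (c≤d : c ≤ d)
  (enclosed : ∀ i → IsVertex n i → c ≤ Y (P i) × Y (P i) ≤ d) where

  open DrawnStacks drawn

  sheared-stack : ∀ k → 9 ℕ.+ k ℕ.* 3 ℕ.≤ n → Stack (shear (1ℤ + (d - c)) ∘ stackAt P k)
  sheared-stack k fits = record
    { distinct = λ vi vj i≢j → shear-distinct _ _ c≤d
        (enclosed _ (isVertex-shift k fits vi)) (enclosed _ (isVertex-shift k fits vj))
        (distinct k fits vi vj i≢j)
    ; disjoint = λ ind → disjoint k fits ind ∘ meets-unshear (1ℤ + (d - c))
        {{ℤ.≢-nonZero (≢-sym (<⇒≢ (+-mono-<-≤ {0ℤ} {1ℤ} (ℤ.+<+ (s≤s z≤n)) (i≤j⇒0≤j-i c≤d))))}}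
    }

  spreads : ℕ → ℤ
  spreads k = spreadAt (stackAt P k) 1

  spreads-bounds : ∀ k → 3 ℕ.+ k ℕ.* 3 ℕ.≤ n → 0ℤ ≤ spreads k × spreads k ≤ d - c
  spreads-bounds k fits =
    i≤j⇒0≤j-i (≤-trans (≤-trans (i⊓j≤i (Y v₁ ⊓ Y v₂) (Y v₃)) (i⊓j≤i (Y v₁) (Y v₂)))
                       (≤-trans (i≤i⊔j (Y v₁) (Y v₂)) (i≤i⊔j (Y v₁ ⊔ Y v₂) (Y v₃)))) ,
    +-mono-≤ (⊔-lub (⊔-lub (proj₂ in₁) (proj₂ in₂)) (proj₂ in₃))
             (neg-mono-≤ (⊓-glb (⊓-glb (proj₁ in₁) (proj₁ in₂)) (proj₁ in₃)))
    where
    v₁ = stackAt P k 1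
    v₂ = stackAt P k 2
    v₃ = stackAt P k 3
    in₁ = enclosed (1 ℕ.+ k ℕ.* 3) (s≤s z≤n , ℕ.≤-trans (ℕ.m≤n+m _ 2) fits)
    in₂ = enclosed (2 ℕ.+ k ℕ.* 3) (s≤s z≤n , ℕ.≤-trans (ℕ.m≤n+m _ 1) fits)
    in₃ = enclosed (3 ℕ.+ k ℕ.* 3) (s≤s z≤n , fits)

  ∣spreads∣-mono : ∀ i j → 3 ℕ.+ i ℕ.* 3 ℕ.≤ n → spreads i < spreads j →
    ℤ.∣ spreads i ∣ ℕ.< ℤ.∣ spreads j ∣
  ∣spreads∣-mono i j fits i<j = drop‿+<+ (subst₂ _<_
    (sym (0≤i⇒+∣i∣≡i 0≤i)) (sym (0≤i⇒+∣i∣≡i (≤-trans 0≤i (<⇒≤ i<j)))) i<j)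
    where 0≤i = proj₁ (spreads-bounds i fits)

  -- For m triangles and H = d - c, n = 3m ≤ 3 (2 + 2H) = 6 (H + 1), and H + 1 is the height of the
  -- grid.
  height-bound : 3 ∣ n → + n ≤ + 6 * (d - c + 1ℤ)
  height-bound (divides m refl) = begin
    + (m ℕ.* 3)                    ≤⟨ ℤ.+≤+ (ℕ.*-monoˡ-≤ 3 short) ⟩
    + ((2 ℕ.+ (H ℕ.+ H)) ℕ.* 3)   ≡⟨ pos-* (2 ℕ.+ (H ℕ.+ H)) 3 ⟩
    + (2 ℕ.+ (H ℕ.+ H)) * + 3      ≡⟨ eq (+ H) ⟩
    + 6 * (+ H + 1ℤ)               ≡⟨ cong (λ i → + 6 * (i + 1ℤ)) (0≤i⇒+∣i∣≡i (i≤j⇒0≤j-i c≤d)) ⟩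
    + 6 * (d - c + 1ℤ)             ∎
    where
    open ≤-Reasoning
    H = ℤ.∣ d - c ∣
    eq : ∀ i → (+ 2 + (i + i)) * + 3 ≡ + 6 * (i + 1ℤ)
    eq = solve-∀
    fits : ∀ k j → j ℕ.+ k ℕ.< m → (suc j ℕ.+ k) ℕ.* 3 ℕ.≤ m ℕ.* 3
    fits k j j+k<m = ℕ.*-monoˡ-≤ 3 j+k<m
    short : m ℕ.≤ 2 ℕ.+ (H ℕ.+ H)
    short = no-valley⇒short (λ k → ℤ.∣ spreads k ∣) H m
      (λ k k<m → let 0≤s , s≤ = spreads-bounds k (fits k 0 k<m) in
        drop‿+≤+ (subst₂ _≤_ (sym (0≤i⇒+∣i∣≡i 0≤s)) (sym (0≤i⇒+∣i∣≡i (i≤j⇒0≤j-i c≤d))) s≤))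
      (λ k k+2<m → ⊎.map
        (∣spreads∣-mono k (1 ℕ.+ k) (fits k 0 (ℕ.≤-trans (ℕ.m≤n+m _ 2) k+2<m)))
        (∣spreads∣-mono (2 ℕ.+ k) (1 ℕ.+ k) (fits k 2 k+2<m))
        -- The shear fixes ordinates, so the three spreads compared are `spreads` at k, k + 1 and k
        -- + 2.
        (middle-spread-exceeds (sheared-stack k (fits k 2 k+2<m))))

-- Exchange of the coordinates

transpose : Pointℤ → Pointℤ
transpose (x , y) = y , x

transpose-drawn : ∀ {n P} → DrawnStacks n P → DrawnStacks n (transpose ∘ P)
transpose-drawn drawn = record
  { distinct = λ k fits vi vj i≢j → distinct k fits vi vj i≢j ∘ cong transpose
  ; disjoint = λ k fits ind → disjoint k fits ind ∘ meets-transpose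
  }
  where
  open DrawnStacks drawn
  meets-transpose : ∀ {p q r s} →
    Meets (transpose p) (transpose q) (transpose r) (transpose s) → Meets p q r s
  meets-transpose m = record
    { 0≤α = 0≤α ; 0≤β = 0≤β ; 0≤γ = 0≤γ ; 0≤δ = 0≤δ ; 0<α+β = 0<α+β ; α+β≡γ+δ = α+β≡γ+δ
    ; X-common = Y-common ; Y-common = X-common }
    where open Meets m

theorem1 : ∃[ k ] (NonZero k ×
    (∀ (n : ℕ) → 9 ℕ.≤ n → 3 ∣ n →
    ∀ (pos : ℕ → Pointℤ) → PlanarGridDrawingStory n 9 pos →
    ∀ (a b c d : ℤ) → a ℤ.< b → c ℤ.< d → Encloses n pos a b c d →
    (+ n ℤ.≤ + k ℤ.* (b ℤ.- a ℤ.+ + 1)) ×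
    (+ n ℤ.≤ + k ℤ.* (d ℤ.- c ℤ.+ + 1))))
theorem1 = 6 , _ , λ n _ 3∣n pos story a b c d a<b c<d enclosed →
  let drawn = story⇒drawnStacks story in
  height-bound (transpose-drawn drawn) (<⇒≤ a<b) (λ i v → proj₁ (enclosed i v)) 3∣n ,
  height-bound drawn (<⇒≤ c<d) (λ i v → proj₂ (enclosed i v)) 3∣n
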